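{- Let $M,N\in\mathcal{X}$ be such that $\{M,N\}$ is adequate. Then the remainder set $R_M(N)$ of $N$ over $M$ is finite.
   Context: Standing assumptions and notation. Assume $2^{\omega_1}=\omega_2$ and fix a bijection $\pi:\omega_2\to H(\omega_2)$. $P_{\omega_1}(\omega_2)$ is the set of countable subsets of $\omega_2$. Assume there is a stationary set $\mathcal{Y}\subseteq P_{\omega_1}(\omega_2)$ which is thin, i.e. for all $\beta<\omega_2$ the set $\{a\cap\beta: a\in\mathcal{Y}\}$ has size at most $\omega_1$; fix such a $\mathcal{Y}$ which is moreover closed under initial segments ($a\in\mathcal{Y}$, $\beta<\omega_2$ imply $a\cap\beta\in\mathcal{Y}$). Let $\mathcal{A}$ be the structure $(H(\omega_2),\in,\pi,\mathcal{Y})$, which has definable Skolem functions (via the well-ordering induced by $\pi$). For $a\subseteq H(\omega_2)$, $Sk(a)$ is the closure of $a$ under a fixed set of definable Skolem functions for $\mathcal{A}$. Let $C$ be the (club) set of $\beta<\omega_2$ with $Sk(\beta)\cap\omega_2=\beta$, and let $\Lambda$ be the set of $\beta<\omega_2$ of cofinality $\omega_1$ which are limit points of $C$. Let $\mathcal{X}$ be the set of $M\in\mathcal{Y}$ such that $Sk(M)\cap\omega_2=M$ and for all $\gamma\in M$, $\sup(C\cap\gamma)\in M$. Comparison points and adequacy. Fix a set $\Gamma\subseteq\Lambda$ which is stationary in $\omega_2$. For $M\in\mathcal{X}$, $\Gamma_M$ is the set of $\beta\in\Gamma$ such that $\beta=\min(\Gamma\setminus\sup(M\cap\beta))$, i.e.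 $\Gamma\cap[\sup(M\cap\beta),\beta)=\emptyset$. For $M,N\in\mathcal{X}$, $\Gamma_M\cap\Gamma_N$ has a largest element, denoted $\beta_{M,N}$. A set $A\subseteq\mathcal{X}$ is adequate if for all $M,N\in A$, either $M\cap\beta_{M,N}=N\cap\beta_{M,N}$, or $M\cap\beta_{M,N}\in Sk(N)$, or $N\cap\beta_{M,N}\in Sk(M)$. Remainders. For $\{M,N\}$ adequate, $R_M(N)$ is the set of $\beta$ satisfying either: (1) there is $\gamma\ge\beta_{M,N}$ in $M$ such that $\beta=\min(N\setminus\gamma)$; or (2) $N\cap\beta_{M,N}$ is either equal to $M\cap\beta_{M,N}$ or is in $Sk(M)$, and $\beta=\min(N\setminus\beta_{M,N})$. (Minima are considered only when the set in question is nonempty.) -}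

module Defs where

open import Data.Empty using (⊥)
open import Data.Fin.Base using (Fin)
open import Data.Maybe.Base using (Maybe; just; nothing)
open import Data.Nat.Base using (ℕ; zero; suc)
open import Data.Product.Base using (Σ; Σ-syntax; ∃; ∃-syntax; _×_; _,_; proj₁; proj₂)
open import Data.Sum.Base using (_⊎_)
open import Data.Vec.Functional using (_∷_)
open import Function.Bundles using (Func; Injection; Bijection; _⇔_)
open import Level using (Level; 0ℓ) renaming (suc to lsuc; _⊔_ to _⊔ˡ_)
open import Relation.Binary.Bundles using (Setoid)
open import Relation.Binary.Construct.Closure.Transitive using (TransClosure)
import Relation.Binary.PropositionalEquality.Properties as ≡
open import Relation.Nullary.Negation using (¬_)
open import Relation.Unary using (Pred)

private
  variable
    p q : Level

infix 4 _≐_ _∈_ _∉_ _⊆_ _≤_ _∈⁺_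

------------------------------------------------------------------------
-- The universe of sets

-- Aczel's cumulative hierarchy.  Under excluded middle and the axiom of
-- choice it is a universe of ZFC, in which everything below takes place.
-- Equality of sets is `_≐_`, not `_≡_`.

data V : Set₁ where
  set : (I : Set) → (I → V) → V

_≐_ : V → V → Set
set I f ≐ set J g = (∀ i → ∃[ j ] f i ≐ g j) × (∀ j → ∃[ i ] f i ≐ g j)

_∈_ : V → V → Set
x ∈ set I f = ∃[ i ] x ≐ f i

_∉_ : V → V → Set
x ∉ a = ¬ (x ∈ a)

_⊆_ : V → V → Set₁
a ⊆ b = ∀ x → x ∈ a → x ∈ b

≐-refl : ∀ {x} → x ≐ x
≐-refl {set I f} = (λ i → i , ≐-refl) , (λ i → i , ≐-refl)

≐-sym : ∀ {x y} → x ≐ y → y ≐ x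
≐-sym {set I f} {set J g} (s , t) =
  (λ j → proj₁ (t j) , ≐-sym (proj₂ (t j))) ,
  (λ i → proj₁ (s i) , ≐-sym (proj₂ (s i)))

≐-trans : ∀ {x y z} → x ≐ y → y ≐ z → x ≐ z
≐-trans {set I f} {set J g} {set K h} (s , t) (s′ , t′) =
  (λ i → proj₁ (s′ (proj₁ (s i))) ,
         ≐-trans (proj₂ (s i)) (proj₂ (s′ (proj₁ (s i))))) ,
  (λ k → proj₁ (t (proj₁ (t′ k))) ,
         ≐-trans (proj₂ (t (proj₁ (t′ k)))) (proj₂ (t′ k)))

_∩_ : V → V → V
set I f ∩ b = set (Σ[ i ∈ I ] f i ∈ b) (λ (i , _) → f i)

⋃ : V → V
⋃ (set I f) = set (Σ[ i ∈ I ] index (f i)) (λ (i , j) → element (f i) j)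
  where
  index : V → Set
  index (set J g) = J

  element : (x : V) → index x → V
  element (set J g) = g

numeral : ℕ → V
numeral zero    = set ⊥ (λ ())
numeral (suc n) with numeral n
... | set I f = set (Maybe I) λ { (just i) → f i ; nothing → set I f }

ω : V
ω = set ℕ numeral

AxiomOfChoice : Set₁
AxiomOfChoice =
  (𝒰 : V) →
  (∀ u → u ∈ 𝒰 → ∃[ x ] x ∈ u) →
  (∀ u v x → u ∈ 𝒰 → v ∈ 𝒰 → x ∈ u → x ∈ v → u ≐ v) →
  ∃[ t ] (∀ u → u ∈ 𝒰 →
    ∃[ x ] x ∈ t × x ∈ u × (∀ y → y ∈ t → y ∈ u → y ≐ x))

------------------------------------------------------------------------
-- Size

-- Functions between sets, or between classes, are functions between their
-- setoids of elements; under excluded middle those between sets are the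
-- same as functional sets of ordered pairs.

⟪_⟫ : Pred V p → Setoid (lsuc 0ℓ ⊔ˡ p) 0ℓ
⟪ P ⟫ = record
  { Carrier       = ∃ P
  ; _≈_           = λ x y → proj₁ x ≐ proj₁ y
  ; isEquivalence = record { refl = ≐-refl ; sym = ≐-sym ; trans = ≐-trans }
  }

El : V → Setoid (lsuc 0ℓ) 0ℓ
El a = ⟪ (λ x → x ∈ a) ⟫

IsFinite : Pred V p → Set (lsuc 0ℓ ⊔ˡ p)
IsFinite P = ∃[ n ] Bijection ⟪ P ⟫ (≡.setoid (Fin n))

_∈⁺_ : V → V → Set₁
_∈⁺_ = TransClosure _∈_

-- H(κ): the sets whose transitive closure has cardinality less than κ.

H : V → Pred V (lsuc 0ℓ)
H κ x = Injection tc (El κ) × ¬ Injection (El κ) tc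
  where tc = ⟪ (λ y → y ∈⁺ x) ⟫

------------------------------------------------------------------------
-- Ordinals

IsTransitive : Pred V (lsuc 0ℓ)
IsTransitive x = ∀ y → y ∈ x → y ⊆ x

IsOrdinal : Pred V (lsuc 0ℓ)
IsOrdinal x = IsTransitive x × (∀ y → y ∈ x → IsTransitive y)

_≤_ : V → V → Set
α ≤ β = α ∈ β ⊎ α ≐ β

IsMin : V → Pred V p → Set (lsuc 0ℓ ⊔ˡ p)
IsMin β P = P β × (∀ ξ → P ξ → β ≤ ξ)

IsMax : V → Pred V p → Set (lsuc 0ℓ ⊔ˡ p)
IsMax β P = P β × (∀ ξ → P ξ → ξ ≤ β)

IsSup : V → Pred V p → Set (lsuc 0ℓ ⊔ˡ p)
IsSup σ P = IsOrdinal σ × (∀ ξ → P ξ → ξ ≤ σ)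
          × (∀ τ → IsOrdinal τ → (∀ ξ → P ξ → ξ ≤ τ) → σ ≤ τ)

-- λ is the least ordinal of cardinality greater than κ.

IsSuccessorCardinal : (κ λ⁺ : V) → Set₁
IsSuccessorCardinal κ λ⁺ =
  IsOrdinal λ⁺ × ¬ Injection (El λ⁺) (El κ)
  × (∀ α → α ∈ λ⁺ → Injection (El α) (El κ))

IsLimitPoint : V → Pred V p → Set (lsuc 0ℓ ⊔ˡ p)
IsLimitPoint β P =
  (∃[ α ] α ∈ β) × (∀ α → α ∈ β → ∃[ ξ ] P ξ × α ∈ ξ × ξ ∈ β)

IsCofinalMap : (α β : V) → Func (El α) (El β) → Set₁
IsCofinalMap α β f = ∀ ξ → ξ ∈ β → ∃[ i ] ξ ≤ proj₁ (Func.to f i)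

HasCofinality : (β κ : V) → Set₁
HasCofinality β κ =
  (Σ[ f ∈ Func (El κ) (El β) ] IsCofinalMap κ β f)
  × (∀ α → α ∈ κ → ¬ (Σ[ f ∈ Func (El α) (El β) ] IsCofinalMap α β f))

------------------------------------------------------------------------
-- Club and stationary sets

IsClub : (κ D : V) → Set₁
IsClub κ D =
  D ⊆ κ
  × (∀ α → α ∈ κ → ∃[ β ] β ∈ D × α ∈ β)
  × (∀ β → β ∈ κ → IsLimitPoint β (λ ξ → ξ ∈ D) → β ∈ D)

IsStationary : (κ S : V) → Set₁
IsStationary κ S =
  S ⊆ κ × (∀ D → IsClub κ D → ∃[ β ] β ∈ S × β ∈ D)

Pω₁ : V → Pred V (lsuc 0ℓ)
Pω₁ κ a = a ⊆ κ × Injection (El a) (El ω)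

IsClubInPω₁ : (κ 𝒞 : V) → Set₁
IsClubInPω₁ κ 𝒞 =
  (∀ a → a ∈ 𝒞 → Pω₁ κ a)
  × (∀ a → Pω₁ κ a → ∃[ b ] b ∈ 𝒞 × a ⊆ b)
  × (∀ (s : ℕ → V) → (∀ n → s n ∈ 𝒞) → (∀ n → s n ⊆ s (suc n)) →
       ⋃ (set ℕ s) ∈ 𝒞)

IsStationaryInPω₁ : (κ 𝒮 : V) → Set₁
IsStationaryInPω₁ κ 𝒮 =
  (∀ a → a ∈ 𝒮 → Pω₁ κ a)
  × (∀ 𝒞 → IsClubInPω₁ κ 𝒞 → ∃[ a ] a ∈ 𝒮 × a ∈ 𝒞)

------------------------------------------------------------------------
-- The standing assumptions

record Assumptions : Set₁ where
  field
    ω₁ ω₂    : V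
    ω₁-succ  : IsSuccessorCardinal ω ω₁
    ω₂-succ  : IsSuccessorCardinal ω₁ ω₂
    2^ω₁≡ω₂  : Bijection ⟪ (λ x → x ⊆ ω₁) ⟫ (El ω₂)
    π        : Bijection (El ω₂) ⟪ H ω₂ ⟫
    𝒴            : V
    𝒴-stationary : IsStationaryInPω₁ ω₂ 𝒴
    𝒴-thin       : ∀ β → β ∈ ω₂ →
                   Injection ⟪ (λ x → ∃[ a ] a ∈ 𝒴 × x ≐ a ∩ β) ⟫ (El ω₁)
    𝒴-initial    : ∀ a β → a ∈ 𝒴 → β ∈ ω₂ → (a ∩ β) ∈ 𝒴

------------------------------------------------------------------------
-- The structure 𝒜 = (H(ω₂), ∈, π, 𝒴)

-- `Formula n`: first-order formulas in n free variables, as de Bruijn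
-- indices; `var-π i j` says that the j-th is the value of π at the i-th.

data Formula (n : ℕ) : Set where
  var-≐ var-∈ var-π : (i j : Fin n) → Formula n
  var-𝒴             : (i : Fin n) → Formula n
  not               : Formula n → Formula n
  _and_             : Formula n → Formula n → Formula n
  exists            : Formula (suc n) → Formula n

module _ (𝔄 : Assumptions) where
  open Assumptions 𝔄

  ∣𝒜∣ : Set₁
  ∣𝒜∣ = ∃ (H ω₂)

  _⊨_ : ∀ {n} → (Fin n → ∣𝒜∣) → Formula n → Set₁
  e ⊨ var-≐ i j = Level.Lift _ (proj₁ (e i) ≐ proj₁ (e j))
  e ⊨ var-∈ i j = Level.Lift _ (proj₁ (e i) ∈ proj₁ (e j))
  e ⊨ var-π i j = Level.Lift _ (Σ[ m ∈ proj₁ (e i) ∈ ω₂ ]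
                    proj₁ (Bijection.to π (proj₁ (e i) , m)) ≐ proj₁ (e j))
  e ⊨ var-𝒴 i   = Level.Lift _ (proj₁ (e i) ∈ 𝒴)
  e ⊨ not φ     = ¬ (e ⊨ φ)
  e ⊨ (φ and ψ) = (e ⊨ φ) × (e ⊨ ψ)
  e ⊨ exists φ  = ∃[ x ] (x ∷ e) ⊨ φ

  record DefinableSkolemFunctions : Set₁ where
    field
      skolem    : ∀ {n} → Formula (suc n) → (Fin n → ∣𝒜∣) → ∣𝒜∣
      isSkolem  : ∀ {n} (φ : Formula (suc n)) (e : Fin n → ∣𝒜∣) →
                  (∃[ x ] (x ∷ e) ⊨ φ) → (skolem φ e ∷ e) ⊨ φ
      definable : ∀ {n} (φ : Formula (suc n)) →
                  Σ[ ψ ∈ Formula (suc n) ] (∀ e x →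
                    ((x ∷ e) ⊨ ψ) ⇔ (proj₁ x ≐ proj₁ (skolem φ e)))

module Models (𝔄 : Assumptions) (𝔉 : DefinableSkolemFunctions 𝔄) where
  open Assumptions 𝔄
  open DefinableSkolemFunctions 𝔉

  -- `Sk a x` says that x ∈ Sk(a), for a ⊆ H(ω₂).

  data Sk (a : V) : Pred V (lsuc 0ℓ) where
    base : ∀ {x} → x ∈ a → Sk a x
    step : ∀ {x n} (φ : Formula (suc n)) (e : Fin n → ∣𝒜∣ 𝔄) →
           (∀ i → Sk a (proj₁ (e i))) → x ≐ proj₁ (skolem φ e) → Sk a x

  Sk∩ω₂≐_ : Pred V (lsuc 0ℓ)
  Sk∩ω₂≐ a = ∀ x → (Sk a x × x ∈ ω₂) ⇔ (x ∈ a)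

  C : Pred V (lsuc 0ℓ)
  C β = β ∈ ω₂ × Sk∩ω₂≐ β

  Λ : Pred V (lsuc 0ℓ)
  Λ β = β ∈ ω₂ × HasCofinality β ω₁ × IsLimitPoint β C

  𝒳 : Pred V (lsuc 0ℓ)
  𝒳 M = M ∈ 𝒴 × Sk∩ω₂≐ M
      × (∀ γ → γ ∈ M → ∃[ σ ] IsSup σ (λ ξ → C ξ × ξ ∈ γ) × σ ∈ M)

  module Comparison (Γ : V) where

    -- `Γ[ M ] β` says that β ∈ Γ_M.

    Γ[_] : V → Pred V (lsuc 0ℓ)
    Γ[ M ] β = β ∈ Γ × (∃[ σ ] IsSup σ (λ ξ → ξ ∈ (M ∩ β))
                             × IsMin β (λ ξ → ξ ∈ Γ × ξ ∉ σ))

    -- β = β_{M,N}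

    IsComparisonPoint : (M N β : V) → Set₁
    IsComparisonPoint M N β = IsMax β (λ ξ → Γ[ M ] ξ × Γ[ N ] ξ)

    Adequate : Pred V p → Set (lsuc 0ℓ ⊔ˡ p)
    Adequate A =
      (∀ M → A M → 𝒳 M)
      × (∀ M N → A M → A N → ∀ β → IsComparisonPoint M N β →
           ((M ∩ β) ≐ (N ∩ β)) ⊎ Sk N (M ∩ β) ⊎ Sk M (N ∩ β))

    -- `R M N β ζ` says that ζ ∈ R_M(N), where β = β_{M,N}.

    R : (M N β : V) → Pred V (lsuc 0ℓ)
    R M N β ζ =
      (∃[ γ ] γ ∈ M × β ≤ γ × IsMin ζ (λ ξ → ξ ∈ N × ξ ∉ γ))
      ⊎ (((N ∩ β) ≐ (M ∩ β) ⊎ Sk M (N ∩ β))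
         × IsMin ζ (λ ξ → ξ ∈ N × ξ ∉ β))

{-# OPTIONS --safe #-}

-- R_M(N) has no limit point.  All its elements are at least β_{M,N}, and
-- between two of them lies an element of M, so a limit point ξ ∈ ω₂ would be
-- a limit point of both M and N; then min(Γ∖ξ) lies in Γ_M ∩ Γ_N although
-- it is above β_{M,N}.  If R_M(N) were cofinal in ω₂, the successors of its
-- elements would form a club, having no limit points below ω₂, and this club
-- would miss Γ, which consists of limit ordinals.  A class of ordinals
-- without limit points is finite below every ordinal, by induction.

module Submission where

open import Defs
open import Axiom.ExcludedMiddle using (ExcludedMiddle)
open import Data.Empty using (⊥-elim)
open import Data.Fin.Base using (Fin; zero; suc)
open import Data.Fin.Properties using (suc-injective)
open import Data.Nat.Base using (ℕ)
open import Data.Product.Base using (Σ-syntax; ∃; ∃-syntax; _×_; _,_; proj₁; proj₂)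
open import Data.Sum.Base using (_⊎_; inj₁; inj₂; [_,_]′)
import Function.Construct.Composition as Composition
open import Function.Base using (id)
open import Function.Bundles using (Bijection; Equivalence; Injection)
open import Induction.WellFounded using (Acc; acc; WellFounded; wf⇒asym)
open import Level using (0ℓ; Lift; lift; lower) renaming (suc to lsuc)
open import Relation.Binary.Construct.Closure.Transitive using ([_]) renaming (_∷_ to _∷⁺_)
open import Relation.Binary.PropositionalEquality.Core using (_≡_; refl; cong; trans)
open import Relation.Nullary.Decidable using (yes; no; True; toWitness; fromWitness; map′; decidable-stable)
open import Relation.Nullary.Negation using (¬_; contradiction)
open import Relation.Unary using (Pred)

private
  variable
    a b c x y : V

-- Membership and order up to extensional equality.

∈-respˡ : x ≐ y → x ∈ a → y ∈ a
∈-respˡ {a = set I f} x≐y (i , x≐fi) = i , ≐-trans (≐-sym x≐y) x≐fi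

∈-respʳ : a ≐ b → x ∈ a → x ∈ b
∈-respʳ {set I f} {set J g} (s , _) (i , x≐fi) = proj₁ (s i) , ≐-trans x≐fi (proj₂ (s i))

≤-respˡ : x ≐ y → x ≤ a → y ≤ a
≤-respˡ x≐y (inj₁ x∈a) = inj₁ (∈-respˡ x≐y x∈a)
≤-respˡ x≐y (inj₂ x≐a) = inj₂ (≐-trans (≐-sym x≐y) x≐a)

∈-∩⁺ : x ∈ a → x ∈ b → x ∈ (a ∩ b)
∈-∩⁺ {a = set I f} (i , x≐fi) x∈b = (i , ∈-respˡ x≐fi x∈b) , x≐fi

∈-∩⁻ : x ∈ (a ∩ b) → x ∈ a × x ∈ b
∈-∩⁻ {a = set I f} ((i , fi∈b) , x≐fi) = (i , x≐fi) , ∈-respˡ (≐-sym x≐fi) fi∈b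

∈-≤-trans : IsTransitive c → a ∈ b → b ≤ c → a ∈ c
∈-≤-trans {c} {a} {b} tr a∈b (inj₁ b∈c) = tr b b∈c a a∈b
∈-≤-trans         _  a∈b (inj₂ b≐c) = ∈-respʳ b≐c a∈b

≤-∈-trans : IsTransitive c → a ≤ b → b ∈ c → a ∈ c
≤-∈-trans {c} {a} {b} tr (inj₁ a∈b) b∈c = tr b b∈c a a∈b
≤-∈-trans         _  (inj₂ a≐b) b∈c = ∈-respˡ (≐-sym a≐b) b∈c

Acc-resp-≐ : x ≐ y → Acc _∈_ x → Acc _∈_ y
Acc-resp-≐ x≐y (acc rs) = acc λ z∈y → rs (∈-respʳ (≐-sym x≐y) z∈y)

∈-wellFounded : WellFounded _∈_
∈-wellFounded (set I f) = acc λ { (i , x≐fi) → Acc-resp-≐ (≐-sym x≐fi) (∈-wellFounded (f i)) }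

∈-asym : x ∈ y → y ∉ x
∈-asym = wf⇒asym ∈-wellFounded

∈-irrefl : x ∉ x
∈-irrefl x∈x = ∈-asym x∈x x∈x

∈-ordinal : IsOrdinal a → x ∈ a → IsOrdinal x
∈-ordinal {a} {x} (tr , trs) x∈a = trs x x∈a , λ y y∈x → trs y (tr x x∈a y y∈x)

ordinal-resp : a ≐ b → IsOrdinal a → IsOrdinal b
ordinal-resp a≐b (tr , trs) =
  (λ y y∈b z z∈y → ∈-respʳ a≐b (tr y (∈-respʳ (≐-sym a≐b) y∈b) z z∈y)) ,
  (λ y y∈b → trs y (∈-respʳ (≐-sym a≐b) y∈b))

≤⇒∌ : a ≤ b → b ∉ a
≤⇒∌ (inj₁ a∈b) b∈a = ∈-asym a∈b b∈a
≤⇒∌ (inj₂ a≐b) b∈a = ∈-irrefl (∈-respʳ a≐b b∈a)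

∖-resp : ∀ a b {x y} → x ≐ y → x ∈ a × x ∉ b → y ∈ a × y ∉ b
∖-resp _ _ x≐y (x∈a , x∉b) = ∈-respˡ x≐y x∈a , λ y∈b → x∉b (∈-respˡ (≐-sym x≐y) y∈b)

IsMin-respˡ : ∀ {p} {P : Pred V p} → (∀ {x y} → x ≐ y → P x → P y) →
              x ≐ y → IsMin x P → IsMin y P
IsMin-respˡ resp x≐y (px , least) = resp x≐y px , λ ξ pξ → ≤-respˡ x≐y (least ξ pξ)

-- Finite classes.

IsFinite-resp : ∀ {p q} {P : Pred V p} {Q : Pred V q} →
                (∀ x → P x → Q x) → (∀ x → Q x → P x) → IsFinite P → IsFinite Q
IsFinite-resp P⇒Q Q⇒P (n , B) = n , record
  { to        = λ (x , qx) → to (x , Q⇒P x qx)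
  ; cong      = to-cong
  ; bijective = injective , λ k → let (x , px) , hit = surjective k in (x , P⇒Q x px) , hit
  }
  where open Bijection B using (to; injective; surjective) renaming (cong to to-cong)

IsFinite-empty : ∀ {p} {P : Pred V p} → (∀ x → ¬ P x) → IsFinite P
IsFinite-empty none = 0 , record
  { to        = λ (x , px) → ⊥-elim (none x px)
  ; cong      = λ { {x , px} → ⊥-elim (none x px) }
  ; bijective = (λ { {x , px} → ⊥-elim (none x px) }) , λ ()
  }

-- The new point goes to `zero` and the old values are shifted by `suc`. Since `a` lies outside the
-- class `P`, which respects `≐`, the two cases never meet in equal sets, so the map is well defined
-- on the setoid.
IsFinite-insert : ∀ {p} {P : Pred V p} → (∀ {x y} → x ≐ y → P x → P y) → ¬ P a →
                  IsFinite P → IsFinite (λ x → P x ⊎ x ≐ a)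
IsFinite-insert {a} {P = P} resp a∉P (n , B) = ℕ.suc n , record
  { to        = to′
  ; cong      = λ {x} {y} → cong′ x y
  ; bijective = (λ {x} {y} → injective′ x y) , surjective′
  }
  where
  open Bijection B using (to; injective; surjective) renaming (cong to to-cong)

  P′ : Pred V _
  P′ x = P x ⊎ x ≐ a

  to′ : ∃ P′ → Fin (ℕ.suc n)
  to′ (x , inj₁ px) = suc (to (x , px))
  to′ (x , inj₂ _)  = zero

  cong′ : ∀ x y → proj₁ x ≐ proj₁ y → to′ x ≡ to′ y
  cong′ (_ , inj₁ _)   (_ , inj₁ _)   x≐y = cong suc (to-cong x≐y)
  cong′ (_ , inj₁ px)  (_ , inj₂ y≐a) x≐y = contradiction (resp (≐-trans x≐y y≐a) px) a∉P
  cong′ (_ , inj₂ x≐a) (_ , inj₁ py)  x≐y = contradiction (resp (≐-trans (≐-sym x≐y) x≐a) py) a∉P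
  cong′ (_ , inj₂ _)   (_ , inj₂ _)   x≐y = refl

  injective′ : ∀ x y → to′ x ≡ to′ y → proj₁ x ≐ proj₁ y
  injective′ (_ , inj₁ _)   (_ , inj₁ _)   eq = injective (suc-injective eq)
  injective′ (_ , inj₂ x≐a) (_ , inj₂ y≐a) eq = ≐-trans x≐a (≐-sym y≐a)

  surjective′ : ∀ k → ∃[ x ] (∀ {z} → proj₁ z ≐ proj₁ x → to′ z ≡ k)
  surjective′ zero    = (a , inj₂ ≐-refl) , λ {z} → cong′ z (a , inj₂ ≐-refl)
  surjective′ (suc k) with surjective k
  ... | (x , px) , hit = (x , inj₁ px) , λ {z} z≐x →
        trans (cong′ z (x , inj₁ px) z≐x) (cong suc (hit ≐-refl))

-- Comparability, minima, separation and finiteness under excluded middle.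

module Classical (em : ExcludedMiddle (lsuc 0ℓ)) where

  em₀ : ExcludedMiddle 0ℓ
  em₀ = map′ lower lift em

  -- Induction on both ordinals. If one is at most some element of the other, transitivity decides.
  -- Otherwise the induction hypotheses put every element of each into the other, and the two are
  -- equal by extensionality.
  ∈-or-≥ : IsOrdinal a → IsOrdinal b → a ∈ b ⊎ b ≤ a
  ∈-or-≥ {set I f} {set J g} oa ob = compare
    (λ i → ∈-or-≥ {f i} {set J g} (∈-ordinal oa (i , ≐-refl)) ob)
    (λ j → ∈-or-≥ {set I f} {g j} oa (∈-ordinal ob (j , ≐-refl)))
    where
    compare : (∀ i → f i ∈ set J g ⊎ set J g ≤ f i) →
              (∀ j → set I f ∈ g j ⊎ g j ≤ set I f) →
              set I f ∈ set J g ⊎ set J g ≤ set I f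
    compare f≷b a≷g with em₀ {∃[ j ] set I f ≤ g j} | em₀ {∃[ i ] set J g ≤ f i}
    ... | yes (j , a≤gj) | _              = inj₁ (≤-∈-trans (proj₁ ob) a≤gj (j , ≐-refl))
    ... | no _           | yes (i , b≤fi) = inj₂ (inj₁ (≤-∈-trans (proj₁ oa) b≤fi (i , ≐-refl)))
    ... | no a≰g         | no b≰f         = inj₂ (inj₂ (g∈a , λ i → let j , fi≐gj = f∈b i in j , ≐-sym fi≐gj))
      where
      f∈b : ∀ i → f i ∈ set J g
      f∈b i with f≷b i
      ... | inj₁ fi∈b = fi∈b
      ... | inj₂ b≤fi = contradiction (i , b≤fi) b≰f

      g∈a : ∀ j → g j ∈ set I f
      g∈a j with a≷g j
      ... | inj₁ a∈gj        = contradiction (j , inj₁ a∈gj) a≰g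
      ... | inj₂ (inj₁ gj∈a) = gj∈a
      ... | inj₂ (inj₂ gj≐a) = contradiction (j , inj₂ (≐-sym gj≐a)) a≰g

  ∉⇒≥ : IsOrdinal a → IsOrdinal b → a ∉ b → b ≤ a
  ∉⇒≥ oa ob a∉b with ∈-or-≥ oa ob
  ... | inj₁ a∈b = contradiction a∈b a∉b
  ... | inj₂ b≤a = b≤a

  ⊆⇒≤ : IsOrdinal a → IsOrdinal b → a ⊆ b → a ≤ b
  ⊆⇒≤ {b = b} oa ob a⊆b = ∉⇒≥ ob oa (λ b∈a → ∈-irrefl (a⊆b b b∈a))

  minimum : {P : Pred V (lsuc 0ℓ)} → (∀ x → P x → IsOrdinal x) → ∃ P → ∃[ x ] IsMin x P
  minimum {P} ord (x , px) = go x (∈-wellFounded x) px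
    where
    go : ∀ x → Acc _∈_ x → P x → ∃[ y ] IsMin y P
    go x (acc rs) px with em {∃[ y ] P y × y ∈ x}
    ... | yes (y , py , y∈x) = go y (rs y∈x) py
    ... | no none = x , px , λ ξ pξ → ∉⇒≥ (ord ξ pξ) (ord x px) (λ ξ∈x → none (ξ , pξ , ξ∈x))

  -- A set needs an index type in `Set`, whereas `P` takes values one level higher; `True` of the
  -- decision given by excluded middle is a small stand-in for `P`.
  separate : V → Pred V (lsuc 0ℓ) → V
  separate (set I f) P = set (Σ[ i ∈ I ] True (em {P (f i)})) (λ (i , _) → f i)

  module _ {P : Pred V (lsuc 0ℓ)} (resp : ∀ {x y} → x ≐ y → P x → P y) where

    ∈-separate⁺ : x ∈ a → P x → x ∈ separate a P
    ∈-separate⁺ {a = set I f} (i , x≐fi) px = (i , fromWitness (resp x≐fi px)) , x≐fi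

    ∈-separate⁻ : x ∈ separate a P → x ∈ a × P x
    ∈-separate⁻ {a = set I f} ((i , pfi) , x≐fi) =
      (i , x≐fi) , resp (≐-sym x≐fi) (toWitness pfi)

    -- Induction on `δ`. Either some `α` below `δ` has no point of `P` strictly between it and `δ`,
    -- and then the points below `δ` are those below `α` together with possibly `α` itself; or there
    -- is no such `α`, and a point of `P` below `δ` would make `δ` a limit point.
    noLimitPoint⇒finite : (∀ x → P x → IsOrdinal x) → (∀ ξ → IsOrdinal ξ → ¬ IsLimitPoint ξ P) →
                          ∀ δ → IsOrdinal δ → IsFinite (λ x → P x × x ∈ δ)
    noLimitPoint⇒finite ord noLimit δ = go δ (∈-wellFounded δ)
      where
      go : ∀ δ → Acc _∈_ δ → IsOrdinal δ → IsFinite (λ x → P x × x ∈ δ)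
      go δ (acc rs) oδ with em {∃[ α ] α ∈ δ × ¬ (∃[ ξ ] P ξ × α ∈ ξ × ξ ∈ δ)}
      ... | no unbounded = IsFinite-empty λ x (_ , x∈δ) → noLimit δ oδ
            ((x , x∈δ) , λ α α∈δ → decidable-stable em (λ none → unbounded (α , α∈δ , none)))
      ... | yes (α , α∈δ , none) with em {P α}
      ...   | no ¬pα = IsFinite-resp
              (λ x (px , x∈α) → px , proj₁ oδ α α∈δ x x∈α)
              (λ x (px , x∈δ) → px , [ id , (λ x≐α → contradiction (resp x≐α px) ¬pα) ]′
                (∉⇒≥ oα (ord x px) (λ α∈x → none (x , px , α∈x , x∈δ))))
              (go α (rs α∈δ) oα)
        where oα = ∈-ordinal oδ α∈δ
      ...   | yes pα = IsFinite-resp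
              (λ x → [ (λ (px , x∈α) → px , proj₁ oδ α α∈δ x x∈α)
                     , (λ x≐α → resp (≐-sym x≐α) pα , ∈-respˡ (≐-sym x≐α) α∈δ) ]′)
              (λ x (px , x∈δ) → [ (λ x∈α → inj₁ (px , x∈α)) , inj₂ ]′
                (∉⇒≥ oα (ord x px) (λ α∈x → none (x , px , α∈x , x∈δ))))
              (IsFinite-insert (λ x≐y (px , x∈α) → resp x≐y px , ∈-respˡ x≐y x∈α)
                (λ (_ , α∈α) → ∈-irrefl α∈α) (go α (rs α∈δ) oα))
        where oα = ∈-ordinal oδ α∈δ

-- The ordinal `ω₂` inside the structure 𝒜.

module Remainders (em : ExcludedMiddle (lsuc 0ℓ))
                  (𝔄 : Assumptions) (𝔉 : DefinableSkolemFunctions 𝔄) where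
  open Classical em
  open Assumptions 𝔄
  open DefinableSkolemFunctions 𝔉
  open Models 𝔄 𝔉

  ω₂-ordinal : IsOrdinal ω₂
  ω₂-ordinal = proj₁ ω₂-succ

  ω₂-transitive : IsTransitive ω₂
  ω₂-transitive = proj₁ ω₂-ordinal

  ∈ω₂⇒ordinal : x ∈ ω₂ → IsOrdinal x
  ∈ω₂⇒ordinal = ∈-ordinal ω₂-ordinal

  -- An ordinal contains its own transitive closure, so an injection of `ω₂` into that closure would
  -- compose with one of `x` into `ω₁`, against the choice of `ω₂`.
  ∈ω₂⇒H : x ∈ ω₂ → H ω₂ x
  ∈ω₂⇒H {x} x∈ω₂ =
    inclusion (λ y y∈⁺x → ω₂-transitive x x∈ω₂ y (∈⁺⇒∈ y∈⁺x)) ,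
    λ ω₂↣tc → proj₁ (proj₂ ω₂-succ)
      (Composition.injection (Composition.injection ω₂↣tc (inclusion (λ _ → ∈⁺⇒∈)))
                             (proj₂ (proj₂ ω₂-succ) x x∈ω₂))
    where
    inclusion : ∀ {p q} {P : Pred V p} {Q : Pred V q} →
                (∀ y → P y → Q y) → Injection ⟪ P ⟫ ⟪ Q ⟫
    inclusion P⇒Q = record { to = λ (y , py) → y , P⇒Q y py ; cong = id ; injective = id }

    ∈⁺⇒∈ : ∀ {y} → y ∈⁺ x → y ∈ x
    ∈⁺⇒∈ [ y∈x ] = y∈x
    ∈⁺⇒∈ {y} (_∷⁺_ {y = z} y∈z z∈⁺x) = proj₁ (∈ω₂⇒ordinal x∈ω₂) z (∈⁺⇒∈ z∈⁺x) y y∈z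

  -- ω₂ is the domain of π.
  isOrdinal : ∀ {n} → Fin n → Formula n
  isOrdinal i = exists (var-π (suc i) zero)

  greatestOrdinal : Formula 1
  greatestOrdinal = isOrdinal zero and not (exists (isOrdinal zero and var-∈ (suc zero) zero))

  π-value : x ∈ ω₂ → Σ[ z ∈ ∣𝒜∣ 𝔄 ] Lift (lsuc 0ℓ)
            (Σ[ m ∈ x ∈ ω₂ ] proj₁ (Bijection.to π (x , m)) ≐ proj₁ z)
  π-value {x} x∈ω₂ = Bijection.to π (x , x∈ω₂) , lift (x∈ω₂ , ≐-refl)

  -- A greatest element of ω₂ would be definable, hence an element of c ∈ ω₂.
  C-inhabited⇒ω₂-noMax : ∃ C → ∀ α → α ∈ ω₂ → ∃[ γ ] γ ∈ ω₂ × α ∈ γ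
  C-inhabited⇒ω₂-noMax (c , c∈ω₂ , Sk[c]) α α∈ω₂ = decidable-stable em λ α-max →
    let (_ , lift (top∈ω₂ , _)) , noneAbove = isSkolem greatestOrdinal (λ ())
          ((α , ∈ω₂⇒H α∈ω₂) , π-value α∈ω₂ , λ { ((γ , _) , (_ , lift (γ∈ω₂ , _)) , lift α∈γ) →
            α-max (γ , γ∈ω₂ , α∈γ) })
        top∈c = Equivalence.to (Sk[c] _) (step greatestOrdinal (λ ()) (λ ()) ≐-refl , top∈ω₂)
    in noneAbove ((c , ∈ω₂⇒H c∈ω₂) , π-value c∈ω₂ , lift top∈c)

  -- Clubs that `Γ` meets, and points of `Γ` next above a limit of `M`.

  module _ (Γ : V) (Γ⊆Λ : ∀ β → β ∈ Γ → Λ β) (Γ-stationary : IsStationary ω₂ Γ) where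
    open Comparison Γ

    module _ (ω₂-noMax : ∀ α → α ∈ ω₂ → ∃[ γ ] γ ∈ ω₂ × α ∈ γ) where

      -- The ordinals of `ω₂` that include `ξ` form a club: cofinal because `ω₂` has no greatest
      -- element, closed because the set is closed upwards.
      Γ-unbounded : ∀ ξ → ξ ∈ ω₂ → ∃[ τ ] τ ∈ Γ × ξ ⊆ τ
      Γ-unbounded ξ ξ∈ω₂ =
        let τ , τ∈Γ , τ∈D = proj₂ Γ-stationary D (D⊆ω₂ , unbounded , closed)
        in τ , τ∈Γ , proj₂ (∈-separate⁻ resp τ∈D)
        where
        resp : ∀ {x y} → x ≐ y → ξ ⊆ x → ξ ⊆ y
        resp x≐y ξ⊆x z z∈ξ = ∈-respʳ x≐y (ξ⊆x z z∈ξ)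

        D : V
        D = separate ω₂ (ξ ⊆_)

        D⊆ω₂ : D ⊆ ω₂
        D⊆ω₂ x x∈D = proj₁ (∈-separate⁻ resp x∈D)

        unbounded : ∀ α → α ∈ ω₂ → ∃[ γ ] γ ∈ D × α ∈ γ
        unbounded α α∈ω₂ with ∈-or-≥ (∈ω₂⇒ordinal ξ∈ω₂) (∈ω₂⇒ordinal α∈ω₂)
        ... | inj₁ ξ∈α =
          let γ , γ∈ω₂ , α∈γ = ω₂-noMax α α∈ω₂
              γ-tr = proj₁ (∈ω₂⇒ordinal γ∈ω₂)
          in γ , ∈-separate⁺ resp γ∈ω₂ (γ-tr ξ (γ-tr α α∈γ ξ ξ∈α)) , α∈γ
        ... | inj₂ α≤ξ =
          let γ , γ∈ω₂ , ξ∈γ = ω₂-noMax ξ ξ∈ω₂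
              γ-tr = proj₁ (∈ω₂⇒ordinal γ∈ω₂)
          in γ , ∈-separate⁺ resp γ∈ω₂ (γ-tr ξ ξ∈γ) , ≤-∈-trans γ-tr α≤ξ ξ∈γ

        closed : ∀ δ → δ ∈ ω₂ → IsLimitPoint δ (_∈ D) → δ ∈ D
        closed δ δ∈ω₂ ((α , α∈δ) , lim) =
          let x , x∈D , _ , x∈δ = lim α α∈δ
          in ∈-separate⁺ resp δ∈ω₂ λ z z∈ξ →
               proj₁ (∈ω₂⇒ordinal δ∈ω₂) x x∈δ z (proj₂ (∈-separate⁻ resp x∈D) z z∈ξ)

      -- The successors of a cofinal `P` would form a club, which `Γ` would have to meet in a
      -- successor ordinal, whereas every point of `Λ` is a limit.
      noLimitPoint⇒notCofinal : {P : Pred V (lsuc 0ℓ)} → (∀ x → P x → x ∈ ω₂) →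
                                (∀ ξ → ξ ∈ ω₂ → ¬ IsLimitPoint ξ P) → ¬ IsLimitPoint ω₂ P
      noLimitPoint⇒notCofinal {P} P⊆ω₂ noLimit (_ , cofinal) =
        let τ , τ∈Γ , τ∈D = proj₂ Γ-stationary D (D⊆ω₂ , unbounded , closed)
            _ , s , _ , (_ , s∈τ) , least = ∈-separate⁻ resp τ∈D
            _ , _ , _ , lim = Γ⊆Λ τ τ∈Γ
            -- `τ` is the least ordinal above `s`, yet as a limit point of `C` it has an ordinal
            -- strictly between `s` and itself.
            γ , (γ∈ω₂ , _) , s∈γ , γ∈τ = lim s s∈τ
        in ≤⇒∌ (least γ (∈ω₂⇒ordinal γ∈ω₂ , s∈γ)) γ∈τ
        where
        IsSucc : V → Pred V (lsuc 0ℓ)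
        IsSucc s x = IsMin x (λ y → IsOrdinal y × s ∈ y)

        Successor : Pred V (lsuc 0ℓ)
        Successor x = ∃[ s ] P s × IsSucc s x

        resp : ∀ {x y} → x ≐ y → Successor x → Successor y
        resp x≐y (s , ps , min) = s , ps ,
          IsMin-respˡ (λ x≐y (ox , s∈x) → ordinal-resp x≐y ox , ∈-respʳ x≐y s∈x) x≐y min

        D : V
        D = separate ω₂ Successor

        D⊆ω₂ : D ⊆ ω₂
        D⊆ω₂ x x∈D = proj₁ (∈-separate⁻ resp x∈D)

        unbounded : ∀ α → α ∈ ω₂ → ∃[ γ ] γ ∈ D × α ∈ γ
        unbounded α α∈ω₂ =
          let s , ps , α∈s , s∈ω₂ = cofinal α α∈ω₂
              δ , δ∈ω₂ , s∈δ = ω₂-noMax s s∈ω₂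
              γ , γ-succ@((oγ , s∈γ) , least) =
                minimum {λ y → IsOrdinal y × s ∈ y} (λ _ → proj₁) (δ , ∈ω₂⇒ordinal δ∈ω₂ , s∈δ)
              γ∈ω₂ = ≤-∈-trans ω₂-transitive (least δ (∈ω₂⇒ordinal δ∈ω₂ , s∈δ)) δ∈ω₂
          in γ , ∈-separate⁺ resp γ∈ω₂ (s , ps , γ-succ) , proj₁ oγ s s∈γ α α∈s

        closed : ∀ δ → δ ∈ ω₂ → IsLimitPoint δ (_∈ D) → δ ∈ D
        closed δ δ∈ω₂ (nonempty , lim) = ⊥-elim (noLimit δ δ∈ω₂ (nonempty , λ α α∈δ →
          -- Closure holds vacuously: a limit point of `D` would be one of `P`. Of two points `x`
          -- and `x′` of `D` above `α`, the larger is the successor of some `s` in `P`, and then `x`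
          -- is at most `s`, so `s` lies above `α` and below `δ`.
          let x , x∈D , α∈x , x∈δ = lim α α∈δ
              x′ , x′∈D , x∈x′ , x′∈δ = lim x x∈δ
              x∈ω₂ , _ = ∈-separate⁻ resp x∈D
              _ , s , ps , (_ , s∈x′) , least = ∈-separate⁻ resp x′∈D
              os = ∈ω₂⇒ordinal (P⊆ω₂ s ps)
              x≤s = ∉⇒≥ os (∈ω₂⇒ordinal x∈ω₂) (λ s∈x → ≤⇒∌ (least x (∈ω₂⇒ordinal x∈ω₂ , s∈x)) x∈x′)
          in s , ps , ∈-≤-trans (proj₁ os) α∈x x≤s
                 , proj₁ (∈ω₂⇒ordinal δ∈ω₂) x′ x′∈δ s s∈x′))

    -- `M` is cofinal in `ξ`, and `ξ` is included in `τ`, so the supremum of `M ∩ τ` is at least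
    -- `ξ`. A point of `Γ` not below that supremum therefore includes `ξ`, and `τ` is the least
    -- point of `Γ` that does.
    Γ[]-limitPoint : ∀ {M ξ τ} → M ⊆ ω₂ → IsLimitPoint ξ (_∈ M) →
                     IsMin τ (λ x → x ∈ Γ × ξ ⊆ x) → Γ[ M ] τ
    Γ[]-limitPoint {M} {ξ} {τ} M⊆ω₂ (_ , lim) ((τ∈Γ , ξ⊆τ) , least) =
      τ∈Γ , σ , (σ-ordinal , upper , below) , (τ∈Γ , λ τ∈σ → ∈-irrefl (σ⊆τ τ τ∈σ)) ,
      λ x (x∈Γ , x∉σ) → least x (x∈Γ , λ z z∈ξ → decidable-stable em₀ λ z∉x →
        -- If `z` in `ξ` were missing from `x`, then `x` would be at most `z`, hence below some `y`
        -- in `M ∩ τ`, hence below the supremum.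
        let y , y∈M , z∈y , y∈ξ = lim z z∈ξ
            oy = ∈ω₂⇒ordinal (M⊆ω₂ y y∈M)
            x≤z = ∉⇒≥ (∈-ordinal oy z∈y) (Γ-ordinal x∈Γ) z∉x
            x∈y = ≤-∈-trans (proj₁ oy) x≤z z∈y
            y∈τ = ξ⊆τ y y∈ξ
        in x∉σ (∈σ⁺ (∈-∩⁺ y∈M y∈τ) x∈y))
      where
      Γ-ordinal : ∀ {x} → x ∈ Γ → IsOrdinal x
      Γ-ordinal {x} x∈Γ = ∈ω₂⇒ordinal (proj₁ (Γ⊆Λ x x∈Γ))

      τ-ordinal : IsOrdinal τ
      τ-ordinal = Γ-ordinal τ∈Γ

      BelowM∩τ : Pred V (lsuc 0ℓ)
      BelowM∩τ x = ∃[ y ] y ∈ (M ∩ τ) × x ∈ y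

      resp : ∀ {x y} → x ≐ y → BelowM∩τ x → BelowM∩τ y
      resp x≐y (z , z∈M∩τ , x∈z) = z , z∈M∩τ , ∈-respˡ x≐y x∈z

      -- The union of `M ∩ τ`, which is its supremum, cut out of the transitive set `τ`.
      σ : V
      σ = separate τ BelowM∩τ

      ∈σ⁺ : ∀ {x y} → y ∈ (M ∩ τ) → x ∈ y → x ∈ σ
      ∈σ⁺ {x} {y} y∈M∩τ x∈y =
        ∈-separate⁺ resp (proj₁ τ-ordinal y (proj₂ (∈-∩⁻ y∈M∩τ)) x x∈y) (y , y∈M∩τ , x∈y)

      σ⊆τ : σ ⊆ τ
      σ⊆τ x x∈σ = proj₁ (∈-separate⁻ resp x∈σ)

      σ-ordinal : IsOrdinal σ
      σ-ordinal =
        (λ x x∈σ w w∈x →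
          let x∈τ , y , y∈M∩τ , x∈y = ∈-separate⁻ resp x∈σ
              y∈τ = proj₂ (∈-∩⁻ y∈M∩τ)
          in ∈σ⁺ y∈M∩τ (proj₁ (∈-ordinal τ-ordinal y∈τ) x x∈y w w∈x)) ,
        (λ x x∈σ → proj₁ (∈-ordinal τ-ordinal (σ⊆τ x x∈σ)))

      upper : ∀ y → y ∈ (M ∩ τ) → y ≤ σ
      upper y y∈M∩τ = ⊆⇒≤ (∈-ordinal τ-ordinal (proj₂ (∈-∩⁻ y∈M∩τ))) σ-ordinal
                          (λ x x∈y → ∈σ⁺ y∈M∩τ x∈y)

      below : ∀ ρ → IsOrdinal ρ → (∀ y → y ∈ (M ∩ τ) → y ≤ ρ) → σ ≤ ρ
      below ρ oρ bound = ⊆⇒≤ σ-ordinal oρ λ x x∈σ →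
        let _ , y , y∈M∩τ , x∈y = ∈-separate⁻ resp x∈σ
        in ∈-≤-trans (proj₁ oρ) x∈y (bound y y∈M∩τ)

    -- The remainder set has no limit point.

    module _ {M N β : V} (M⊆ω₂ : M ⊆ ω₂) (N⊆ω₂ : N ⊆ ω₂)
             (β-comparison : IsComparisonPoint M N β) where

      β∈Γ : β ∈ Γ
      β∈Γ = proj₁ (proj₁ (proj₁ β-comparison))

      β∈ω₂ : β ∈ ω₂
      β∈ω₂ = proj₁ (Γ⊆Λ β β∈Γ)

      -- The comparison point lies in `Λ`, so it is a limit point of `C`, and `C` is inhabited.
      ω₂-noMax : ∀ α → α ∈ ω₂ → ∃[ γ ] γ ∈ ω₂ × α ∈ γ
      ω₂-noMax =
        let _ , _ , (α , α∈β) , lim = Γ⊆Λ β β∈Γ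
            γ , Cγ , _ = lim α α∈β
        in C-inhabited⇒ω₂-noMax (γ , Cγ)

      R⊆N : ∀ x → R M N β x → x ∈ N
      R⊆N _ (inj₁ (_ , _ , _ , (x∈N , _) , _)) = x∈N
      R⊆N _ (inj₂ (_ , (x∈N , _) , _))         = x∈N

      R⊆ω₂ : ∀ x → R M N β x → x ∈ ω₂
      R⊆ω₂ x x∈R = N⊆ω₂ x (R⊆N x x∈R)

      R-resp : ∀ {x y} → x ≐ y → R M N β x → R M N β y
      R-resp x≐y (inj₁ (γ , γ∈M , β≤γ , min)) =
        inj₁ (γ , γ∈M , β≤γ , IsMin-respˡ (∖-resp N γ) x≐y min)
      R-resp x≐y (inj₂ (N∩β , min)) = inj₂ (N∩β , IsMin-respˡ (∖-resp N β) x≐y min)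

      R-≥β : ∀ x → R M N β x → β ≤ x
      R-≥β x (inj₁ (γ , γ∈M , β≤γ , (x∈N , x∉γ) , _)) =
        ∉⇒≥ (∈ω₂⇒ordinal (N⊆ω₂ x x∈N)) (∈ω₂⇒ordinal β∈ω₂) λ x∈β →
          x∉γ (∈-≤-trans (proj₁ (∈ω₂⇒ordinal (M⊆ω₂ γ γ∈M))) x∈β β≤γ)
      R-≥β x (inj₂ (_ , (x∈N , x∉β) , _)) = ∉⇒≥ (∈ω₂⇒ordinal (N⊆ω₂ x x∈N)) (∈ω₂⇒ordinal β∈ω₂) x∉β

      -- If `y` is the least element of `N` not below `γ`, then the smaller element `x` of `N` is
      -- below `γ`. The second clause cannot produce `y`: it makes `y` the least element of `N` from
      -- `β` on, but `x` is smaller and also at least `β`.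
      R-separated : ∀ {x y} → R M N β x → R M N β y → x ∈ y → ∃[ γ ] γ ∈ M × x ∈ γ × γ ≤ y
      R-separated {x} {y} x∈R (inj₁ (γ , γ∈M , _ , (y∈N , y∉γ) , least)) x∈y =
        γ , γ∈M
          , decidable-stable em₀ (λ x∉γ → ≤⇒∌ (least x (R⊆N x x∈R , x∉γ)) x∈y)
          , ∉⇒≥ (∈ω₂⇒ordinal (N⊆ω₂ y y∈N)) (∈ω₂⇒ordinal (M⊆ω₂ γ γ∈M)) y∉γ
      R-separated {x} {y} x∈R (inj₂ (_ , _ , least)) x∈y =
        contradiction x∈y (≤⇒∌ (least x (R⊆N x x∈R , ≤⇒∌ (R-≥β x x∈R))))

      R-noLimitPoint∈ω₂ : ∀ ξ → ξ ∈ ω₂ → ¬ IsLimitPoint ξ (R M N β)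
      R-noLimitPoint∈ω₂ ξ ξ∈ω₂ (nonempty@(α , α∈ξ) , lim) =
        let τ , τ-min@((_ , ξ⊆τ) , _) =
              minimum {λ x → x ∈ Γ × ξ ⊆ x} (λ x (x∈Γ , _) → ∈ω₂⇒ordinal (proj₁ (Γ⊆Λ x x∈Γ)))
                      (Γ-unbounded ω₂-noMax ξ ξ∈ω₂)
            x , x∈R , _ , x∈ξ = lim α α∈ξ
            β∈ξ = ≤-∈-trans ξ-transitive (R-≥β x x∈R) x∈ξ
            -- Both `M` and `N` are cofinal in `ξ`, so `τ` is a common point of `Γ[ M ]` and
            -- `Γ[ N ]`; maximality bounds it by `β`, although `β` lies in `ξ` and so in `τ`.
            τ≤β = proj₂ β-comparison τ
              (Γ[]-limitPoint M⊆ω₂ M-limit τ-min , Γ[]-limitPoint N⊆ω₂ N-limit τ-min)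
        in ≤⇒∌ τ≤β (ξ⊆τ β β∈ξ)
        where
        ξ-transitive : IsTransitive ξ
        ξ-transitive = proj₁ (∈ω₂⇒ordinal ξ∈ω₂)

        N-limit : IsLimitPoint ξ (_∈ N)
        N-limit = nonempty , λ α α∈ξ →
          let x , x∈R , α∈x , x∈ξ = lim α α∈ξ in x , R⊆N x x∈R , α∈x , x∈ξ

        M-limit : IsLimitPoint ξ (_∈ M)
        M-limit = nonempty , λ α α∈ξ →
          -- Two remainder points above `α` are taken, so that the element of `M` separating them
          -- lies above `α` and still below `ξ`.
          let x , x∈R , α∈x , x∈ξ = lim α α∈ξ
              y , y∈R , x∈y , y∈ξ = lim x x∈ξ
              γ , γ∈M , x∈γ , γ≤y = R-separated x∈R y∈R x∈y
          in γ , γ∈M , proj₁ (∈ω₂⇒ordinal (M⊆ω₂ γ γ∈M)) x x∈γ α α∈x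
               , ≤-∈-trans ξ-transitive γ≤y y∈ξ

      -- Above `ω₂` there is nothing to accumulate, since remainder points lie in `ω₂`. The case of
      -- `ω₂` itself is the one that rests on the club of successors.
      R-noLimitPoint : ∀ ξ → IsOrdinal ξ → ¬ IsLimitPoint ξ (R M N β)
      R-noLimitPoint ξ oξ ξ-limit@(nonempty , lim) with ∈-or-≥ oξ ω₂-ordinal
      ... | inj₁ ξ∈ω₂        = R-noLimitPoint∈ω₂ ξ ξ∈ω₂ ξ-limit
      ... | inj₂ (inj₁ ω₂∈ξ) = let x , x∈R , ω₂∈x , _ = lim ω₂ ω₂∈ξ in ∈-asym ω₂∈x (R⊆ω₂ x x∈R)
      ... | inj₂ (inj₂ ω₂≐ξ) =
        noLimitPoint⇒notCofinal ω₂-noMax R⊆ω₂ R-noLimitPoint∈ω₂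
          ((β , β∈ω₂) , λ α α∈ω₂ →
            let x , x∈R , α∈x , _ = lim α (∈-respʳ ω₂≐ξ α∈ω₂) in x , x∈R , α∈x , R⊆ω₂ x x∈R)

      R-finite : IsFinite (R M N β)
      R-finite = IsFinite-resp (λ _ → proj₁) (λ x x∈R → x∈R , R⊆ω₂ x x∈R)
        (noLimitPoint⇒finite R-resp (λ x x∈R → ∈ω₂⇒ordinal (R⊆ω₂ x x∈R)) R-noLimitPoint
          ω₂ ω₂-ordinal)

proposition2p9 : ExcludedMiddle (lsuc 0ℓ) → AxiomOfChoice →
    (𝔄 : Assumptions) (𝔉 : DefinableSkolemFunctions 𝔄) →
    let open Assumptions 𝔄
        open Models 𝔄 𝔉
    in
    (Γ : V) → (∀ β → β ∈ Γ → Λ β) → IsStationary ω₂ Γ →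
    let open Comparison Γ in
    (M N : V) → 𝒳 M → 𝒳 N → Adequate (λ x → x ≐ M ⊎ x ≐ N) →
    (β : V) → IsComparisonPoint M N β →
    IsFinite (R M N β)
proposition2p9 em _ 𝔄 𝔉 Γ Γ⊆Λ Γ-stationary M N (M∈𝒴 , _) (N∈𝒴 , _) _ β =
  R-finite Γ Γ⊆Λ Γ-stationary (𝒴⇒⊆ω₂ M∈𝒴) (𝒴⇒⊆ω₂ N∈𝒴)
  where
  open Assumptions 𝔄
  open Remainders em 𝔄 𝔉

  𝒴⇒⊆ω₂ : ∀ {a} → a ∈ 𝒴 → a ⊆ ω₂
  𝒴⇒⊆ω₂ {a} a∈𝒴 = proj₁ (proj₁ 𝒴-stationary a a∈𝒴)
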